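{- Let $r\ge 3$ and $k\ge 2$ be integers, and let $t=(r-1)(k-1)+1$. Let $n\ge 1$ be an integer with $t\mid n$, and assume that a Steiner system $S(2,r,t)$ exists. Then for every linear $r$-uniform hypertree $T_k^r$ with $k$ hyperedges, $$ex_r^{\mathrm{lin}}(n,T_k^r)\ge \frac{n(k-1)}{r}.$$ This bound is sharp when $T_k^r$ is the star $S_k^r$, i.e. whenever $r\ge 3$, $k\ge 2$ and $n\ge 1$ are integers such that $(r-1)(k-1)+1$ divides $n$ and a Steiner system $S(2,r,(r-1)(k-1)+1)$ exists, one has $ex_r^{\mathrm{lin}}(n,S_k^r)=\frac{n(k-1)}{r}$.
   Context: All hypergraphs are finite. A hypergraph is $r$-uniform if each hyperedge has exactly $r$ vertices, and linear if any two distinct hyperedges intersect in at most one vertex. A linear $r$-uniform hypertree $T_k^r$ on $k$ hyperedges is a connected, acyclic, linear $r$-uniform hypergraph with exactly $k$ hyperedges; here acyclic means that there is no sequence of distinct hyperedges $e_1,\dots,e_s$ with $s\ge 3$ such that $e_i\cap e_{i+1}\ne\emptyset$ for all $i$ (indices modulo $s$) and all these intersections are distinct. $S_k^r$ is the $r$-uniform linear star: $k$ hyperedges of size $r$ sharing one common vertex and otherwise pairwise disjoint. A hypergraph $H$ contains $F$ as a subhypergraph if there is an injective map $V(F)\to V(H)$ sending every hyperedge of $F$ to a hyperedge of $H$; otherwise $H$ is $F$-free. The linear Turán number $ex_r^{\mathrm{lin}}(n,F)$ is the maximum number of hyperedges in an $F$-free linear $r$-uniform hypergraph on $n$ vertices.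 A Steiner system $S(2,r,m)$ is a set of $m$ vertices together with a family of $r$-element subsets (blocks, viewed as hyperedges) such that every pair of distinct vertices lies in exactly one block. -}

module Defs where

open import Data.Bool.Base using (Bool; true; false; if_then_else_)
import Data.Bool.Properties as Bool
open import Data.Fin.Base using (Fin; zero; suc; toℕ; funToFin; finToFun)
open import Data.Fin.Properties using (_≟_; any?; injective⇒≤; finToFun-funToFin)
  renaming (all? to allᶠ?)
open import Data.Fin.Subset using (Subset; _∈_; _∩_; ∣_∣; ⁅_⁆; Nonempty)
open import Data.Fin.Subset.Properties using (_∈?_; anySubset?)
open import Data.List.Base using (List; []; _∷_; length; lookup)
open import Data.List.Membership.Propositional using () renaming (_∈_ to _∈ₗ_)
open import Data.List.Membership.Propositional.Properties using (∈-lookup)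
open import Data.List.Relation.Unary.All using (All)
  renaming (all? to allᴸ?; map to mapAll; lookup to lookupAll)
open import Data.List.Relation.Unary.AllPairs.Core using () renaming (_∷_ to _∷ᵖ_)
open import Data.List.Relation.Unary.Unique.Propositional using (Unique)
open import Data.Nat.Base using (ℕ; zero; suc; _≤_; _^_; z≤n; s≤s⁻¹)
open import Data.Nat.DivMod using (_mod_)
open import Data.Nat.Properties using (m≤n⇒m<n∨m≡n; _≤?_; suc-injective)
  renaming (_≟_ to _≟ⁿ_)
open import Data.Product using (∃; ∃-syntax; ∃!; _×_; _,_; proj₁)
open import Data.Sum.Base using (inj₁; inj₂)
open import Data.Vec.Base using (tabulate) renaming (lookup to lookupᵛ)
open import Data.Vec.Properties using (tabulate-cong; ≡-dec; tabulate∘lookup)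
open import Function.Base using (_∘_)
open import Function.Bundles using (mk⇔)
open import Function.Definitions using (Injective)
open import Relation.Binary.Construct.Closure.ReflexiveTransitive using (Star)
open import Relation.Binary.Definitions using (DecidableEquality)
open import Level using (0ℓ)
open import Relation.Binary.PropositionalEquality
open import Relation.Nullary using (¬_; Dec; yes; no; does; contradiction)
open import Relation.Nullary.Decidable using (map′; _×-dec_; _→-dec_; ¬?; does-⇔)
open import Relation.Unary using (Pred; Decidable)

infix 4 _≟ˢ_

-- A finite hypergraph on the vertex set Fin n; its hyperedges form a set,
-- given as a duplicate-free list.
record Hypergraph (n : ℕ) : Set where
  constructor hypergraph
  field
    edges  : List (Subset n)
    unique : Unique edges

open Hypergraph public

size : ∀ {n} → Hypergraph n → ℕ
size H = length (edges H)

Uniform : ∀ {n} → ℕ → Hypergraph n → Set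
Uniform r H = All (λ e → ∣ e ∣ ≡ r) (edges H)

Linear : ∀ {n} → Hypergraph n → Set
Linear H = All (λ e → All (λ f → e ≢ f → ∣ e ∩ f ∣ ≤ 1) (edges H)) (edges H)

Adjacent : ∀ {n} → Hypergraph n → Fin n → Fin n → Set
Adjacent H u v = ∃[ e ] e ∈ₗ edges H × u ∈ e × v ∈ e

-- Every two vertices are joined by a walk; in particular, a connected
-- hypergraph with at least two vertices has no isolated vertices.
Connected : ∀ {n} → Hypergraph n → Set
Connected H = ∀ u v → Star (Adjacent H) u v

cyclicSuc : ∀ {s} → Fin (suc s) → Fin (suc s)
cyclicSuc {s} i = suc (toℕ i) mod suc s

record IsCycle {n s : ℕ} (H : Hypergraph n) (e : Fin (suc s) → Subset n) : Set where
  field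
    length≥3               : 3 ≤ suc s
    hyperedges             : ∀ i → e i ∈ₗ edges H
    distinct               : Injective _≡_ _≡_ e
    consecutive-meet       : ∀ i → Nonempty (e i ∩ e (cyclicSuc i))
    distinct-intersections : Injective _≡_ _≡_ (λ i → e i ∩ e (cyclicSuc i))

Acyclic : ∀ {n} → Hypergraph n → Set
Acyclic {n} H = ∀ {s} (e : Fin (suc s) → Subset n) → ¬ IsCycle H e

record IsLinearHypertree {n : ℕ} (r k : ℕ) (T : Hypergraph n) : Set where
  field
    connected : Connected T
    acyclic   : Acyclic T
    linear    : Linear T
    uniform   : Uniform r T
    size≡k    : size T ≡ k

-- The linear star, characterised up to isomorphism.  The last field makes the
-- vertex set the union of the hyperedges.
record IsLinearStar {n : ℕ} (r k : ℕ) (S : Hypergraph n) : Set where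
  field
    uniform  : Uniform r S
    size≡k   : size S ≡ k
    centre   : Fin n
    centred  : ∀ {e} → e ∈ₗ edges S → centre ∈ e
    disjoint : ∀ {e f} → e ∈ₗ edges S → f ∈ₗ edges S → e ≢ f → e ∩ f ≡ ⁅ centre ⁆
    covered  : ∀ v → ∃[ e ] e ∈ₗ edges S × v ∈ e

-- S(2, r, m), with m the number of vertices.
record IsSteinerSystem {m : ℕ} (r : ℕ) (B : Hypergraph m) : Set where
  field
    uniform    : Uniform r B
    pair-block : ∀ {x y} → x ≢ y → ∃! _≡_ (λ e → e ∈ₗ edges B × x ∈ e × y ∈ e)

preimage? : ∀ {m n} (φ : Fin m → Fin n) (e : Subset m) (y : Fin n) →
            Dec (∃ λ x → x ∈ e × φ x ≡ y)
preimage? φ e y = any? (λ x → (x ∈? e) ×-dec (φ x ≟ y))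

image : ∀ {m n} → (Fin m → Fin n) → Subset m → Subset n
image φ e = tabulate (λ y → does (preimage? φ e y))

IsEmbedding : ∀ {m n} → Hypergraph m → Hypergraph n → (Fin m → Fin n) → Set
IsEmbedding F H φ = Injective _≡_ _≡_ φ × All (λ e → image φ e ∈ₗ edges H) (edges F)

Contains : ∀ {m n} → Hypergraph n → Hypergraph m → Set
Contains H F = ∃ (IsEmbedding F H)

record Admissible {m n : ℕ} (r : ℕ) (F : Hypergraph m) (H : Hypergraph n) : Set where
  constructor admissible
  field
    linear  : Linear H
    uniform : Uniform r H
    free    : ¬ Contains H F

Attainable : ∀ {m} → ℕ → (n : ℕ) → Hypergraph m → ℕ → Set
Attainable r n F x = ∃ λ (H : Hypergraph n) → size H ≡ x × Admissible r F H

_≟ˢ_ : ∀ {n} → DecidableEquality (Subset n)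
_≟ˢ_ = ≡-dec Bool._≟_

module _ {n : ℕ} where
  open import Data.List.Membership.DecPropositional (_≟ˢ_ {n}) public
    using () renaming (_∈?_ to _∈ₗ?_)
  open import Data.List.Relation.Unary.Unique.DecPropositional (_≟ˢ_ {n}) public
    using (unique?)

image-cong : ∀ {m n} {φ ψ : Fin m → Fin n} → φ ≗ ψ → image φ ≗ image ψ
image-cong {φ = φ} {ψ} φ≗ψ e = tabulate-cong λ y → does-⇔
  (mk⇔ (λ (x , x∈e , φx≡y) → x , x∈e , trans (sym (φ≗ψ x)) φx≡y)
       (λ (x , x∈e , ψx≡y) → x , x∈e , trans (φ≗ψ x) ψx≡y))
  (preimage? φ e y) (preimage? ψ e y)

embedding-resp : ∀ {m n} (F : Hypergraph m) (H : Hypergraph n) {φ ψ} →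
                 φ ≗ ψ → IsEmbedding F H φ → IsEmbedding F H ψ
embedding-resp F H φ≗ψ (inj , emb) =
  (λ {x} {y} eq → inj (trans (φ≗ψ x) (trans eq (sym (φ≗ψ y))))) ,
  mapAll (λ {e} → subst (_∈ₗ edges H) (image-cong φ≗ψ e)) emb

embedding? : ∀ {m n} (F : Hypergraph m) (H : Hypergraph n) → Decidable (IsEmbedding F H)
embedding? F H φ =
  map′ (λ inj {x} {y} → inj x y) (λ inj x y → inj {x} {y})
    (allᶠ? λ x → allᶠ? λ y → (φ x ≟ φ y) →-dec (x ≟ y))
  ×-dec allᴸ? (λ e → image φ e ∈ₗ? edges H) (edges F)

contains? : ∀ {m n} (H : Hypergraph n) (F : Hypergraph m) → Dec (Contains H F)
contains? {m} {n} H F = map′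
  (λ (c , emb) → finToFun c , emb)
  (λ (φ , emb) → funToFin φ ,
     embedding-resp F H (λ x → sym (finToFun-funToFin φ x)) emb)
  (any? (λ (c : Fin (n ^ m)) → embedding? F H (finToFun c)))

admissible? : ∀ {m n} r (F : Hypergraph m) → Decidable (Admissible {n = n} r F)
admissible? r F H = map′
  (λ (l , u , f) → admissible l u f)
  (λ (admissible l u f) → l , u , f)
  (allᴸ?
     (λ e → allᴸ?
       (λ f → ¬? (e ≟ˢ f) →-dec (∣ e ∩ f ∣ ≤? 1)) (edges H)) (edges H)
   ×-dec allᴸ? (λ e → ∣ e ∣ ≟ⁿ r) (edges H)
   ×-dec ¬? (contains? H F))

anyOfLength? : ∀ {n} x {P : Pred (List (Subset n)) 0ℓ} → Decidable P →
               Dec (∃ λ es → length es ≡ x × P es)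
anyOfLength? zero P? = map′
  (λ p → [] , refl , p)
  (λ { ([] , _ , p) → p })
  (P? [])
anyOfLength? (suc x) P? = map′
  (λ (e , es , eq , p) → e ∷ es , cong suc eq , p)
  (λ { (e ∷ es , eq , p) → e , es , suc-injective eq , p })
  (anySubset? λ e → anyOfLength? x (P? ∘ (e ∷_)))

attainable? : ∀ {m} r n (F : Hypergraph m) → Decidable (Attainable r n F)
attainable? r n F x = map′
  (λ (es , eq , u , adm) → hypergraph es u , eq , adm)
  (λ (H , eq , adm) → edges H , eq , unique H , adm)
  (anyOfLength? x admissibleEdges?)
  where
  admissibleEdges? : Decidable (λ es → ∃ λ (u : Unique es) → Admissible r F (hypergraph es u))
  admissibleEdges? es with unique? es
  ... | no ¬u = no (¬u ∘ proj₁)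
  ... | yes u = map′ (u ,_)
    (λ (_ , admissible l un f) → admissible l un f)
    (admissible? r F (hypergraph es u))

greatest : {P : Pred ℕ 0ℓ} → Decidable P → ℕ → ℕ
greatest P? zero    = zero
greatest P? (suc b) = if does (P? (suc b)) then suc b else greatest P? b

-- The linear Turán number: the maximum size of an F-free linear r-uniform
-- hypergraph on n vertices (0 if there is none, which can only happen when F
-- has no hyperedges).  The cut-off 2 ^ n is the number of subsets of Fin n;
-- exˡⁱⁿ-upper and exˡⁱⁿ-attained below show that this is indeed the maximum.
exˡⁱⁿ : ∀ {m} → ℕ → ℕ → Hypergraph m → ℕ
exˡⁱⁿ r n F = greatest (attainable? r n F) (2 ^ n)

greatest-upper : ∀ {P : Pred ℕ 0ℓ} (P? : Decidable P) b {x} → x ≤ b → P x → x ≤ greatest P? b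
greatest-upper P? zero x≤b _ = x≤b
greatest-upper P? (suc b) x≤b px with P? (suc b)
... | yes _ = x≤b
... | no ¬p with m≤n⇒m<n∨m≡n x≤b
...   | inj₁ x<b  = greatest-upper P? b (s≤s⁻¹ x<b) px
...   | inj₂ refl = contradiction px ¬p

greatest-attained : ∀ {P : Pred ℕ 0ℓ} (P? : Decidable P) b {x} → x ≤ b → P x → P (greatest P? b)
greatest-attained P? zero z≤n px = px
greatest-attained P? (suc b) x≤b px with P? (suc b)
... | yes p = p
... | no ¬p with m≤n⇒m<n∨m≡n x≤b
...   | inj₁ x<b  = greatest-attained P? b (s≤s⁻¹ x<b) px
...   | inj₂ refl = contradiction px ¬p

lookup-injective : ∀ {A : Set} {xs : List A} → Unique xs → Injective _≡_ _≡_ (lookup xs)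
lookup-injective {xs = _ ∷ _}  (_ ∷ᵖ _)   {zero}  {zero}  _  = refl
lookup-injective {xs = _ ∷ xs} (x∉ ∷ᵖ _) {zero}  {suc j} eq =
  contradiction eq (lookupAll x∉ (∈-lookup {xs = xs} j))
lookup-injective {xs = _ ∷ xs} (x∉ ∷ᵖ _) {suc i} {zero}  eq =
  contradiction (sym eq) (lookupAll x∉ (∈-lookup {xs = xs} i))
lookup-injective {xs = _ ∷ _}  (_ ∷ᵖ u)   {suc i} {suc j} eq = cong suc (lookup-injective u eq)

private
  bit : Bool → Fin 2
  bit false = zero
  bit true  = suc zero

  bit-injective : Injective _≡_ _≡_ bit
  bit-injective {false} {false} _ = refl
  bit-injective {true}  {true}  _ = refl

  code : ∀ {n} → Subset n → Fin (2 ^ n)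
  code p = funToFin (bit ∘ lookupᵛ p)

  code-injective : ∀ {n} → Injective _≡_ _≡_ (code {n})
  code-injective {_} {p} {q} eq = begin
    p                     ≡⟨ tabulate∘lookup p ⟨
    tabulate (lookupᵛ p)  ≡⟨ tabulate-cong (λ i → bit-injective (pointwise i)) ⟩
    tabulate (lookupᵛ q)  ≡⟨ tabulate∘lookup q ⟩
    q                     ∎
    where
    open ≡-Reasoning
    pointwise : ∀ i → bit (lookupᵛ p i) ≡ bit (lookupᵛ q i)
    pointwise i = begin
      bit (lookupᵛ p i)    ≡⟨ finToFun-funToFin (bit ∘ lookupᵛ p) i ⟨
      finToFun (code p) i  ≡⟨ cong (λ c → finToFun c i) eq ⟩
      finToFun (code q) i  ≡⟨ finToFun-funToFin (bit ∘ lookupᵛ q) i ⟩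
      bit (lookupᵛ q i)    ∎

size≤2^n : ∀ {n} (H : Hypergraph n) → size H ≤ 2 ^ n
size≤2^n H = injective⇒≤ {f = code ∘ lookup (edges H)}
  (lookup-injective (unique H) ∘ code-injective)

exˡⁱⁿ-upper : ∀ {m n} r (F : Hypergraph m) (H : Hypergraph n) →
              Admissible r F H → size H ≤ exˡⁱⁿ r n F
exˡⁱⁿ-upper {n = n} r F H adm =
  greatest-upper (attainable? r n F) (2 ^ n) (size≤2^n H) (H , refl , adm)

exˡⁱⁿ-attained : ∀ {m n} r (F : Hypergraph m) (H : Hypergraph n) →
                 Admissible r F H → Attainable r n F (exˡⁱⁿ r n F)
exˡⁱⁿ-attained {n = n} r F H adm =
  greatest-attained (attainable? r n F) (2 ^ n) (size≤2^n H) (H , refl , adm)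

{-# OPTIONS --safe #-}

-- Lower bound: n / t disjoint copies of the Steiner system have n (k − 1) / r
-- hyperedges.  A connected hypergraph embedded in them stays inside one copy,
-- hence has at most t = (r − 1)(k − 1) + 1 vertices, whereas a hypertree with
-- k hyperedges has at least (r − 1) k + 1: adding its hyperedges one at a time
-- to a connected part U, each new one meets U in a single vertex, since two
-- such vertices would be joined by a path in U closing up to a cycle.
--
-- Upper bound for the star: k hyperedges through a vertex of a linear
-- hypergraph form a star, so all degrees are at most k − 1; sum the degrees.

module Submission where

open import Defs
open import Data.Bool.Base using (true; false)
open import Data.Fin.Base
  using (Fin; zero; suc; toℕ; fromℕ; inject₁; inject≤; splitAt; quotient; remainder; combine)
open import Data.Fin.Properties
  using ( _≟_; any?; toℕ-injective; toℕ-fromℕ; toℕ-fromℕ<; toℕ-inject₁; toℕ<n; suc-injective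
        ; injective⇒≤; inject≤-injective; combine-remQuot; punchInᵢ≢i )
open import Data.Fin.Relation.Unary.Top using (view; ‵fromℕ; ‵inject₁)
open import Data.Fin.Subset
open import Data.Fin.Subset.Properties
open import Data.Integer.Base as ℤ using (+_; +≤+)
import Data.Integer.Properties as ℤ
open import Data.List.Base as List using (List; []; _∷_; length; lookup; map; filter)
open import Data.List.Membership.Propositional using (find) renaming (_∈_ to _∈ₗ_; _∉_ to _∉ₗ_)
open import Data.List.Membership.Propositional.Properties
  using (∈-lookup; ∈-map⁻; ∈-++⁻; ∈-filter⁺; ∈-filter⁻)
open import Data.List.Properties using (length-++; length-map; filter-all)
open import Data.List.Relation.Binary.Subset.Propositional using () renaming (_⊆_ to _⊆ₗ_)
open import Data.List.Relation.Unary.All as All using (All; []; _∷_)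
open import Data.List.Relation.Unary.All.Properties using (¬All⇒Any¬)
open import Data.List.Relation.Unary.AllPairs using ([]; _∷_)
open import Data.List.Relation.Unary.Any using (here; there; index)
open import Data.List.Relation.Unary.Any.Properties using (lookup-index)
open import Data.List.Relation.Unary.Unique.Propositional using (Unique)
import Data.List.Relation.Unary.Unique.Propositional.Properties as Unique
open import Data.Nat.Base using (ℕ; zero; suc; NonZero; _+_; _*_; _∸_; _≤_; _<_; z≤n; s≤s; _%_)
open import Data.Nat.Divisibility using (_∣_; divides)
open import Data.Nat.DivMod using (m<n⇒m%n≡m; n%n≡0; m%n<n)
import Data.Nat.Properties as ℕ
open import Data.Nat.Solver using (module +-*-Solver)
open import Data.Product.Base using (_×_; _,_; ∃-syntax; proj₁; proj₂)
open import Data.Rational.Base using (_/_; toℚᵘ) renaming (_≥_ to _≥ℚ_)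
open import Data.Rational.Properties using (toℚᵘ-cancel-≤; toℚᵘ-fromℚᵘ; fromℚᵘ-cong)
open import Data.Rational.Unnormalised.Base using (mkℚᵘ; *≤*; *≡*)
import Data.Rational.Unnormalised.Properties as ℚᵘ
open import Data.Sum.Base using (_⊎_; inj₁; inj₂; [_,_]′)
open import Data.Vec.Base using ([]; _∷_; _++_; here; there)
open import Data.Vec.Functional using (removeAt) renaming (_∷_ to _∷ᶠ_)
open import Data.Vec.Properties
  using (++-injectiveˡ; ++-injectiveʳ; lookup∘tabulate; lookup⇒[]=; []=⇒lookup)
open import Algebra.Properties.CommutativeMonoid.Sum ℕ.+-0-commutativeMonoid
  using (sum; sum-cong-≗; sum-remove; ∑-distrib-+)
open import Function.Base using (_∘_; case_of_)
open import Function.Definitions using (Injective)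
open import Relation.Binary.Construct.Closure.ReflexiveTransitive as Star using (Star; ε; _◅_; _◅◅_)
open import Relation.Binary.PropositionalEquality
open import Relation.Nullary using (¬_; Dec; yes; no; does; contradiction)
open import Relation.Nullary.Decidable using (dec-true)

-- Subsets

x∉p-x : ∀ {n} (p : Subset n) x → x ∉ p - x
x∉p-x (true  ∷ p) zero    ()
x∉p-x (false ∷ p) zero    ()
x∉p-x (_ ∷ p)     (suc x) (there x∈) = x∉p-x p x x∈

x∈p⇒∣p∣≡1+∣p-x∣ : ∀ {n} {p : Subset n} {x} → x ∈ p → ∣ p ∣ ≡ suc ∣ p - x ∣
x∈p⇒∣p∣≡1+∣p-x∣ {p = true ∷ p}  here       = cong (suc ∘ ∣_∣) (sym (p─⊥≡p p))
x∈p⇒∣p∣≡1+∣p-x∣ {p = true ∷ p}  (there x∈) = cong suc (x∈p⇒∣p∣≡1+∣p-x∣ x∈)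
x∈p⇒∣p∣≡1+∣p-x∣ {p = false ∷ p} (there x∈) = x∈p⇒∣p∣≡1+∣p-x∣ x∈

1≤∣p∣ : ∀ {n} {p : Subset n} {x} → x ∈ p → 1 ≤ ∣ p ∣
1≤∣p∣ x∈p rewrite x∈p⇒∣p∣≡1+∣p-x∣ x∈p = s≤s z≤n

1≤∣p∣⇒nonempty : ∀ {n} (p : Subset n) → 1 ≤ ∣ p ∣ → Nonempty p
1≤∣p∣⇒nonempty {n} p 1≤p with nonempty? p
... | yes ne = ne
... | no ¬ne rewrite Empty-unique ¬ne | ∣⊥∣≡0 n = case 1≤p of λ ()

∣p∣≤1⇒≡ : ∀ {n} {p : Subset n} {x y} → ∣ p ∣ ≤ 1 → x ∈ p → y ∈ p → x ≡ y
∣p∣≤1⇒≡ {x = x} {y} p≤1 x∈p y∈p with x ≟ y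
... | yes x≡y = x≡y
... | no  x≢y = contradiction (ℕ.≤-trans (s≤s (1≤∣p∣ (x∈p∧x≢y⇒x∈p-y x∈p x≢y)))
                                (subst (_≤ 1) (x∈p⇒∣p∣≡1+∣p-x∣ y∈p) p≤1)) λ { (s≤s ()) }

≡⇒∣p∣≤1 : ∀ {n} {p : Subset n} {x} → (∀ {y} → y ∈ p → y ≡ x) → ∣ p ∣ ≤ 1
≡⇒∣p∣≤1 {p = p} {x} p≡x = subst (∣ p ∣ ≤_) (∣⁅x⁆∣≡1 x)
  (p⊆q⇒∣p∣≤∣q∣ (λ y∈p → subst (_∈ ⁅ x ⁆) (sym (p≡x y∈p)) (x∈⁅x⁆ x)))

∣p∪q∣+∣p∩q∣≡∣p∣+∣q∣ : ∀ {n} (p q : Subset n) → ∣ p ∪ q ∣ + ∣ p ∩ q ∣ ≡ ∣ p ∣ + ∣ q ∣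
∣p∪q∣+∣p∩q∣≡∣p∣+∣q∣ []          []          = refl
∣p∪q∣+∣p∩q∣≡∣p∣+∣q∣ (true ∷ p)  (true ∷ q)  = cong suc
  (trans (ℕ.+-suc _ _) (trans (cong suc (∣p∪q∣+∣p∩q∣≡∣p∣+∣q∣ p q)) (sym (ℕ.+-suc _ _))))
∣p∪q∣+∣p∩q∣≡∣p∣+∣q∣ (true ∷ p)  (false ∷ q) = cong suc (∣p∪q∣+∣p∩q∣≡∣p∣+∣q∣ p q)
∣p∪q∣+∣p∩q∣≡∣p∣+∣q∣ (false ∷ p) (true ∷ q)  =
  trans (cong suc (∣p∪q∣+∣p∩q∣≡∣p∣+∣q∣ p q)) (sym (ℕ.+-suc _ _))
∣p∪q∣+∣p∩q∣≡∣p∣+∣q∣ (false ∷ p) (false ∷ q) = ∣p∪q∣+∣p∩q∣≡∣p∣+∣q∣ p q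

-- Pigeonhole: sending each position of `xs` to a position of the same element in `ys` is injective,
-- because `xs` has no repetitions.
unique-⊆⇒length≤ : ∀ {A : Set} {xs ys : List A} → Unique xs → xs ⊆ₗ ys → length xs ≤ length ys
unique-⊆⇒length≤ {xs = xs} {ys} xs! xs⊆ys =
  injective⇒≤ {f = λ i → index (xs⊆ys (∈-lookup {xs = xs} i))} λ {i} {j} eq →
    lookup-injective xs! (trans (lookup-index (xs⊆ys (∈-lookup {xs = xs} i)))
      (trans (cong (lookup ys) eq) (sym (lookup-index (xs⊆ys (∈-lookup {xs = xs} j))))))

linear⇒≡ : ∀ {n} {H : Hypergraph n} → Linear H → ∀ {e f x y} → e ∈ₗ edges H → f ∈ₗ edges H →
           e ≢ f → x ∈ e → x ∈ f → y ∈ e → y ∈ f → x ≡ y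
linear⇒≡ lin {e} {f} e∈ f∈ e≢f xe xf ye yf =
  ∣p∣≤1⇒≡ (All.lookup (All.lookup lin e∈) f∈ e≢f) (x∈p∩q⁺ (xe , xf)) (x∈p∩q⁺ (ye , yf))

-- Paths and the order of a hypertree

cyclicSuc-inject₁ : ∀ {s} (i : Fin s) → cyclicSuc (inject₁ i) ≡ suc i
cyclicSuc-inject₁ {s} i = toℕ-injective (begin
  toℕ (cyclicSuc (inject₁ i))      ≡⟨ toℕ-fromℕ< (m%n<n (suc (toℕ (inject₁ i))) (suc s)) ⟩
  suc (toℕ (inject₁ i)) % suc s    ≡⟨ cong (λ j → suc j % suc s) (toℕ-inject₁ i) ⟩
  suc (toℕ i) % suc s              ≡⟨ m<n⇒m%n≡m (s≤s (toℕ<n i)) ⟩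
  suc (toℕ i)                      ∎)
  where open ≡-Reasoning

cyclicSuc-fromℕ : ∀ s → cyclicSuc (fromℕ s) ≡ zero
cyclicSuc-fromℕ s = toℕ-injective (begin
  toℕ (cyclicSuc (fromℕ s))      ≡⟨ toℕ-fromℕ< (m%n<n (suc (toℕ (fromℕ s))) (suc s)) ⟩
  suc (toℕ (fromℕ s)) % suc s    ≡⟨ cong (λ j → suc j % suc s) (toℕ-fromℕ s) ⟩
  suc s % suc s                  ≡⟨ n%n≡0 (suc s) ⟩
  0                              ∎)
  where open ≡-Reasoning

-- At least two indices are required: on `Fin 1` the cyclic successor is the identity.
cyclicSuc≢id : ∀ {s} (i : Fin (suc (suc s))) → i ≢ cyclicSuc i
cyclicSuc≢id {s} i eq with view i
... | ‵fromℕ with () ← trans eq (cyclicSuc-fromℕ (suc s))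
... | ‵inject₁ j = ℕ.1+n≢n (sym (trans (sym (toℕ-inject₁ j))
  (cong toℕ (trans eq (cyclicSuc-inject₁ j)))))

-- `Adjacent` relative to an arbitrary list, so that walks can be confined to the hyperedges
-- collected so far.
Joined : ∀ {n} → List (Subset n) → Fin n → Fin n → Set
Joined es u v = ∃[ e ] e ∈ₗ es × u ∈ e × v ∈ e

-- A Berge path. When it is closed up to a cycle, distinctness of its hyperedges gives `distinct`,
-- and distinctness of its vertices gives `distinct-intersections`.
record IsPath {n} (es : List (Subset n)) (p : ℕ)
              (w : Fin (suc p) → Fin n) (f : Fin p → Subset n) : Set where
  field
    vertices-injective : Injective _≡_ _≡_ w
    edges-injective    : Injective _≡_ _≡_ f
    edges∈             : ∀ i → f i ∈ₗ es
    source∈            : ∀ i → w (inject₁ i) ∈ f i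
    target∈            : ∀ i → w (suc i) ∈ f i

record Path {n} (es : List (Subset n)) (u v : Fin n) : Set where
  field
    {p}    : ℕ
    {w}    : Fin (suc p) → Fin n
    {f}    : Fin p → Subset n
    isPath : IsPath es p w f
    start  : w zero ≡ u
    finish : w (fromℕ p) ≡ v

module _ {n} {es : List (Subset n)} where

  trivial-path : ∀ u → IsPath es 0 (λ _ → u) λ ()
  trivial-path u = record
    { vertices-injective = λ { {zero} {zero} _ → refl }
    ; edges-injective    = λ { {()} }
    ; edges∈             = λ ()
    ; source∈            = λ ()
    ; target∈            = λ ()
    }

  path-tail : ∀ {p w f} → IsPath es (suc p) w f → IsPath es p (w ∘ suc) (f ∘ suc)
  path-tail P = record
    { vertices-injective = suc-injective ∘ vertices-injective
    ; edges-injective    = suc-injective ∘ edges-injective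
    ; edges∈             = edges∈ ∘ suc
    ; source∈            = source∈ ∘ suc
    ; target∈            = target∈ ∘ suc
    } where open IsPath P

  path-cons : ∀ {p w f u e} → IsPath es p w f → e ∈ₗ es → u ∈ e → w zero ∈ e →
         (∀ i → w i ≢ u) → (∀ i → f i ≢ e) → IsPath es (suc p) (u ∷ᶠ w) (e ∷ᶠ f)
  path-cons P e∈es u∈e w₀∈e w≢u f≢e = record
    { vertices-injective = λ
        { {zero}  {zero}  _  → refl
        ; {zero}  {suc j} eq → contradiction (sym eq) (w≢u j)
        ; {suc i} {zero}  eq → contradiction eq (w≢u i)
        ; {suc i} {suc j} eq → cong suc (vertices-injective eq) }
    ; edges-injective = λ
        { {zero}  {zero}  _  → refl
        ; {zero}  {suc j} eq → contradiction (sym eq) (f≢e j)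
        ; {suc i} {zero}  eq → contradiction eq (f≢e i)
        ; {suc i} {suc j} eq → cong suc (edges-injective eq) }
    ; edges∈  = λ { zero → e∈es ; (suc i) → edges∈ i }
    ; source∈ = λ { zero → u∈e  ; (suc i) → source∈ i }
    ; target∈ = λ { zero → w₀∈e ; (suc i) → target∈ i }
    } where open IsPath P

  -- Cutting the path back to its last vertex on e keeps it simple: no later
  -- vertex lies on e, so neither u nor e itself occurs again.
  extend-path : ∀ {p w f u e} → IsPath es p w f → e ∈ₗ es → u ∈ e → (∃[ i ] w i ∈ e) →
           Path es u (w (fromℕ p))
  extend-path {p} {w} {f} {u} {e} P e∈es u∈e (i , wᵢ∈e) with any? (λ j → w (suc j) ∈? e)
  extend-path {suc p} P e∈es u∈e _ | yes later = extend-path (path-tail P) e∈es u∈e later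
  extend-path {p} {w} {f} {u} {e} P e∈es u∈e (suc i , wᵢ∈e) | no ¬later =
    contradiction (i , wᵢ∈e) ¬later
  extend-path {p} {w} {f} {u} {e} P e∈es u∈e (zero , w₀∈e) | no ¬later with w zero ≟ u
  ... | yes w₀≡u = record { isPath = P ; start = w₀≡u ; finish = refl }
  ... | no  w₀≢u =
    record { isPath = path-cons P e∈es u∈e w₀∈e w≢u f≢e ; start = refl ; finish = refl }
    where
    w≢u : ∀ i → w i ≢ u
    w≢u zero    = w₀≢u
    w≢u (suc i) eq = ¬later (i , subst (_∈ e) (sym eq) u∈e)
    f≢e : ∀ i → f i ≢ e
    f≢e i eq = ¬later (i , subst (w (suc i) ∈_) eq (IsPath.target∈ P i))

  -- Built from the far end: each step of the walk is put in front of a path that is already simple,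
  -- and `extend-path` cuts away any repetition.
  walk⇒path : ∀ {u v} → Star (Joined es) u v → Path es u v
  walk⇒path {u} ε = record { isPath = trivial-path u ; start = refl ; finish = refl }
  walk⇒path ((e , e∈es , u∈e , x∈e) ◅ walk) with walk⇒path walk
  ... | record { isPath = P ; start = refl ; finish = refl } = extend-path P e∈es u∈e (zero , x∈e)

module _ {n} {T : Hypergraph n} (acyclic : Acyclic T) (linear : Linear T) where

  -- A path of length at least two from `a` to `b`, closed up by `e`, would be a cycle. A path of
  -- length one is a hyperedge other than `e` through `a` and `b`, so linearity identifies them.
  no-chord : ∀ {es e a b} → es ⊆ₗ edges T → e ∈ₗ edges T → e ∉ₗ es →
             a ∈ e → b ∈ e → Path es a b → a ≡ b
  no-chord _ _ _ _ _ record { p = 0 ; start = refl ; finish = refl } = refl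
  no-chord es⊆ e∈ e∉ a∈e b∈e record { p = 1 ; isPath = P ; start = refl ; finish = refl } =
    linear⇒≡ {H = T} linear e∈ (es⊆ (edges∈ zero)) (λ { refl → e∉ (edges∈ zero) })
      a∈e (source∈ zero) b∈e (target∈ zero)
    where open IsPath P
  no-chord {es} {e} es⊆ e∈ e∉ a∈e b∈e
    record { p = p@(suc (suc _)) ; w = w ; f = f ; isPath = P ; start = refl ; finish = refl } =
    contradiction cycle (acyclic c)
    where
    open IsPath P
    -- With `e` in front, `w i` lies in `c i` and in its cyclic successor: `a`, the start of `w`,
    -- joins `e` to the first hyperedge of the path, and `b`, its end, joins the last one back to
    -- `e`.
    c : Fin (suc p) → Subset n
    c = e ∷ᶠ f

    c∈ : ∀ i → c i ∈ₗ edges T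
    c∈ zero    = e∈
    c∈ (suc i) = es⊆ (edges∈ i)

    c-injective : Injective _≡_ _≡_ c
    c-injective {zero}  {zero}  _  = refl
    c-injective {zero}  {suc j} eq = contradiction (subst (_∈ₗ es) (sym eq) (edges∈ j)) e∉
    c-injective {suc i} {zero}  eq = contradiction (subst (_∈ₗ es) eq (edges∈ i)) e∉
    c-injective {suc i} {suc j} eq = cong suc (edges-injective eq)

    w∈c : ∀ i → w i ∈ c i
    w∈c zero    = a∈e
    w∈c (suc i) = target∈ i

    w∈c⁺ : ∀ i → w i ∈ c (cyclicSuc i)
    w∈c⁺ i with view i
    ... | ‵fromℕ     = subst (λ j → w (fromℕ p) ∈ c j) (sym (cyclicSuc-fromℕ p)) b∈e
    ... | ‵inject₁ j = subst (λ k → w (inject₁ j) ∈ c k) (sym (cyclicSuc-inject₁ j)) (source∈ j)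

    w∈ : ∀ i → w i ∈ c i ∩ c (cyclicSuc i)
    w∈ i = x∈p∩q⁺ (w∈c i , w∈c⁺ i)

    cycle : IsCycle T c
    cycle = record
      { length≥3               = s≤s (s≤s (s≤s z≤n))
      ; hyperedges             = c∈
      ; distinct               = c-injective
      ; consecutive-meet       = λ i → w i , w∈ i
      -- By linearity the intersection at `i` contains no vertex but `w i`, so equal intersections
      -- force equal vertices and hence equal indices.
      ; distinct-intersections = λ {i} {j} eq →
          let wⱼ∈ = x∈p∩q⁻ (c i) _ (subst (w j ∈_) (sym eq) (w∈ j)) in
          vertices-injective (linear⇒≡ {H = T} linear (c∈ i) (c∈ (cyclicSuc i))
            (cyclicSuc≢id i ∘ c-injective) (w∈c i) (w∈c⁺ i) (proj₁ wⱼ∈) (proj₂ wⱼ∈))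
      }

module _ {n r} {T : Hypergraph n} (acyclic : Acyclic T) (linear : Linear T)
         (connected : Connected T) (uniform : Uniform (suc r) T) where

  -- `root∈`, `cover` and `walk` make `U` the set of vertices reachable from the root through `es`.
  -- Hyperedges have `suc r` vertices, of which `r` are new at each adjunction, whence `r * j + 1`.
  record Subtree (root : Fin n) (j : ℕ) : Set where
    field
      es      : List (Subset n)
      U       : Subset n
      es⊆     : es ⊆ₗ edges T
      length≡ : length es ≡ j
      root∈   : root ∈ U
      cover   : ∀ {e} → e ∈ₗ es → e ⊆ U
      walk    : ∀ {u} → u ∈ U → Star (Joined es) root u
      large   : r * j + 1 ≤ ∣ U ∣

  -- The first step of the walk that ends outside `U` supplies the hyperedge.
  leaving : ∀ (U : Subset n) {u v} → Star (Adjacent T) u v → u ∈ U → v ∉ U →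
            ∃[ e ] e ∈ₗ edges T × (∃[ a ] a ∈ e × a ∈ U) × ∃[ b ] b ∈ e × b ∉ U
  leaving U ε u∈ v∉ = contradiction u∈ v∉
  leaving U {u} (_◅_ {j = x} (e , e∈ , u∈e , x∈e) walk) u∈ v∉ with x ∈? U
  ... | yes x∈ = leaving U walk x∈ v∉
  ... | no  x∉ = e , e∈ , (u , u∈e , u∈) , x , x∈e , x∉

  -- By pigeonhole some hyperedge of `T` is missing from `es`. If it does not visibly meet `U`,
  -- connectedness yields another missing one that does, and this is adjoined.
  grow : ∀ {root j} → j < size T → Subtree root j → Subtree root (suc j)
  grow {root} {j} j<k S with All.all? (_∈ₗ? Subtree.es S) (edges T)
  ... | yes all = contradiction
    (subst (size T ≤_) (Subtree.length≡ S) (unique-⊆⇒length≤ (unique T) (All.lookup all)))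
    (ℕ.<⇒≱ j<k)
  ... | no ¬all = adjoin (touching (find (¬All⇒Any¬ (_∈ₗ? es) (edges T) ¬all)))
    where
    open Subtree S

    Touching : Set
    Touching = ∃[ e ] e ∈ₗ edges T × e ∉ₗ es × ∃[ a ] a ∈ e × a ∈ U

    touching : (∃[ e ] e ∈ₗ edges T × e ∉ₗ es) → Touching
    touching (e , e∈ , e∉)
      with 1≤∣p∣⇒nonempty e (subst (1 ≤_) (sym (All.lookup uniform e∈)) (s≤s z≤n))
    ... | v , v∈e with v ∈? U
    ...   | yes v∈U = e , e∈ , e∉ , v , v∈e , v∈U
    ...   | no  v∉U with leaving U (connected root v) root∈ v∉U
    -- A hyperedge leaving `U` is new, since those in `es` lie inside `U`.
    ...     | e′ , e′∈ , a∈ , b , b∈e′ , b∉U = e′ , e′∈ , (λ e′∈es → b∉U (cover e′∈es b∈e′)) , a∈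

    symmetric : ∀ {u v} → Joined es u v → Joined es v u
    symmetric (e , e∈ , u∈e , v∈e) = e , e∈ , v∈e , u∈e

    adjoin : Touching → Subtree root (suc j)
    adjoin (e , e∈ , e∉ , a , a∈e , a∈U) = record
      { es      = e ∷ es
      ; U       = U ∪ e
      ; es⊆     = λ { (here refl) → e∈ ; (there f∈) → es⊆ f∈ }
      ; length≡ = cong suc length≡
      ; root∈   = p⊆p∪q e root∈
      ; cover   = λ { (here refl) → q⊆p∪q U e ; (there f∈) → p⊆p∪q e ∘ cover f∈ }
      ; walk    = λ u∈ → [ walk′ , (λ u∈e → walk′ a∈U ◅◅ (e , here refl , a∈e , u∈e) ◅ ε) ]′
                         (x∈p∪q⁻ U e u∈)
      -- The extra `1` on both sides accounts for `U ∩ e`, which has at most one vertex, and avoids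
      -- subtraction.
      ; large   = ℕ.+-cancelʳ-≤ 1 _ _ (begin
          r * suc j + 1 + 1        ≡⟨ cong (λ x → x + 1 + 1)
                                        (trans (ℕ.*-suc r j) (ℕ.+-comm r (r * j))) ⟩
          r * j + r + 1 + 1        ≡⟨ rearrange (r * j) r ⟩
          r * j + 1 + suc r        ≤⟨ ℕ.+-monoˡ-≤ (suc r) large ⟩
          ∣ U ∣ + suc r            ≡⟨ cong (_+_ ∣ U ∣) (All.lookup uniform e∈) ⟨
          ∣ U ∣ + ∣ e ∣            ≡⟨ ∣p∪q∣+∣p∩q∣≡∣p∣+∣q∣ U e ⟨
          ∣ U ∪ e ∣ + ∣ U ∩ e ∣    ≤⟨ ℕ.+-monoʳ-≤ ∣ U ∪ e ∣
                                        (≡⇒∣p∣≤1 λ {b} b∈ → meets-once (x∈p∩q⁻ U e b∈)) ⟩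
          ∣ U ∪ e ∣ + 1            ∎)
      }
      where
      open ℕ.≤-Reasoning
      open +-*-Solver
      rearrange : ∀ x y → x + y + 1 + 1 ≡ x + 1 + suc y
      rearrange = solve 2 (λ x y → x :+ y :+ con 1 :+ con 1 := x :+ con 1 :+ (con 1 :+ y)) refl

      walk′ : ∀ {u} → u ∈ U → Star (Joined (e ∷ es)) root u
      walk′ = Star.map (λ (f , f∈ , uv) → f , there f∈ , uv) ∘ walk

      meets-once : ∀ {b} → b ∈ U × b ∈ e → b ≡ a
      -- Both vertices are linked to the root inside `es`, so a path through `es` joins them and `e`
      -- would be a chord of it.
      meets-once (b∈U , b∈e) = no-chord {T = T} acyclic linear es⊆ e∈ e∉ b∈e a∈e
        (walk⇒path (Star.reverse symmetric (walk b∈U) ◅◅ walk a∈U))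

  subtree : ∀ root j → j ≤ size T → Subtree root j
  subtree root zero _ = record
    { es = [] ; U = ⁅ root ⁆ ; es⊆ = λ () ; length≡ = refl
    ; root∈ = x∈⁅x⁆ root ; cover = λ ()
    ; walk = λ u∈ → subst (Star (Joined []) root) (sym (x∈⁅y⁆⇒x≡y root u∈)) ε
    ; large = ℕ.≤-reflexive (trans (cong (_+ 1) (ℕ.*-zeroʳ r)) (sym (∣⁅x⁆∣≡1 root))) }
  subtree root (suc j) j<k = grow j<k (subtree root j (ℕ.<⇒≤ j<k))

  -- A vertex is given because the hypergraph on `Fin 0` without hyperedges would violate the bound.
  hypertree-order : Fin n → r * size T + 1 ≤ n
  hypertree-order root = ℕ.≤-trans large (∣p∣≤n U)
    where open Subtree (subtree root (size T) ℕ.≤-refl)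

-- Disjoint copies

∣p++q∣≡∣p∣+∣q∣ : ∀ {m n} (p : Subset m) (q : Subset n) → ∣ p ++ q ∣ ≡ ∣ p ∣ + ∣ q ∣
∣p++q∣≡∣p∣+∣q∣ []          q = refl
∣p++q∣≡∣p∣+∣q∣ (true ∷ p)  q = cong suc (∣p++q∣≡∣p∣+∣q∣ p q)
∣p++q∣≡∣p∣+∣q∣ (false ∷ p) q = ∣p++q∣≡∣p∣+∣q∣ p q

++-∩ : ∀ {m n} (p p′ : Subset m) (q q′ : Subset n) → (p ++ q) ∩ (p′ ++ q′) ≡ (p ∩ p′) ++ (q ∩ q′)
++-∩ []      []        q q′ = refl
++-∩ (x ∷ p) (x′ ∷ p′) q q′ = cong (_ ∷_) (++-∩ p p′ q q′)

∣p++⊥∣≡∣p∣ : ∀ {m} n (p : Subset m) → ∣ p ++ ⊥ {n} ∣ ≡ ∣ p ∣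
∣p++⊥∣≡∣p∣ n p = trans (∣p++q∣≡∣p∣+∣q∣ p (⊥ {n}))
  (trans (cong (_+_ ∣ p ∣) (∣⊥∣≡0 n)) (ℕ.+-identityʳ _))

∣⊥++q∣≡∣q∣ : ∀ m {n} (q : Subset n) → ∣ ⊥ {m} ++ q ∣ ≡ ∣ q ∣
∣⊥++q∣≡∣q∣ m q = trans (∣p++q∣≡∣p∣+∣q∣ (⊥ {m}) q) (cong (_+ ∣ q ∣) (∣⊥∣≡0 m))

-- Phrased through `splitAt`, by which `quotient` is computed, so that the copy containing a vertex
-- can be read off by rewriting.
x∈p++⊥⇒left : ∀ {m n} (p : Subset m) {x} → x ∈ p ++ ⊥ {n} → ∃[ y ] splitAt m x ≡ inj₁ y × y ∈ p
x∈p++⊥⇒left []      x∈ = contradiction x∈ ∉⊥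
x∈p++⊥⇒left (_ ∷ p) here = zero , refl , here
x∈p++⊥⇒left {suc m} (_ ∷ p) {suc x} (there x∈) with splitAt m x | x∈p++⊥⇒left p x∈
... | _ | y , refl , y∈ = suc y , refl , there y∈

x∈⊥++q⇒right : ∀ {m n} (q : Subset n) {x} → x ∈ ⊥ {m} ++ q → ∃[ y ] splitAt m x ≡ inj₂ y × y ∈ q
x∈⊥++q⇒right {zero}  q x∈ = _ , refl , x∈
x∈⊥++q⇒right {suc m} q {suc x} (there x∈) with splitAt m x | x∈⊥++q⇒right {m} q x∈
... | _ | y , refl , y∈ = y , refl , y∈

module _ {m n r} (1≤r : 1 ≤ r) (H : Hypergraph m) (K : Hypergraph n)
         (uH : Uniform r H) where

  private
    inˡ : Subset m → Subset (m + n)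
    inˡ = _++ ⊥
    inʳ : Subset n → Subset (m + n)
    inʳ = ⊥ {m} ++_

  disjointUnion-edges : List (Subset (m + n))
  disjointUnion-edges = map inˡ (edges H) List.++ map inʳ (edges K)

  -- A common hyperedge of the two sides would have to be empty; `1 ≤ r` excludes this and keeps the
  -- concatenated list free of repetitions.
  disjointUnion : Hypergraph (m + n)
  disjointUnion = hypergraph disjointUnion-edges
    (Unique.++⁺ (Unique.map⁺ (λ {p} {q} → ++-injectiveˡ p q) (unique H))
                (Unique.map⁺ (++-injectiveʳ (⊥ {m}) ⊥) (unique K))
                disjoint)
    where
    disjoint : ∀ {e} → ¬ (e ∈ₗ map inˡ (edges H) × e ∈ₗ map inʳ (edges K))
    disjoint (e∈ˡ , e∈ʳ) with ∈-map⁻ inˡ e∈ˡ | ∈-map⁻ inʳ e∈ʳ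
    ... | p , p∈ , refl | q , q∈ , eq = ℕ.<⇒≢ 1≤r
      (trans (sym (trans (cong ∣_∣ (++-injectiveˡ p ⊥ eq)) (∣⊥∣≡0 m))) (All.lookup uH p∈))

  Origin : Subset (m + n) → Set
  Origin e = (∃[ p ] p ∈ₗ edges H × e ≡ inˡ p) ⊎ (∃[ q ] q ∈ₗ edges K × e ≡ inʳ q)

  ∈-disjointUnion⁻ : ∀ {e} → e ∈ₗ edges disjointUnion → Origin e
  ∈-disjointUnion⁻ e∈ with ∈-++⁻ (map inˡ (edges H)) e∈
  ... | inj₁ e∈ˡ = inj₁ (∈-map⁻ inˡ e∈ˡ)
  ... | inj₂ e∈ʳ = inj₂ (∈-map⁻ inʳ e∈ʳ)

  size-disjointUnion : size disjointUnion ≡ size H + size K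
  size-disjointUnion = trans (length-++ (map inˡ (edges H)))
    (cong₂ _+_ (length-map inˡ (edges H)) (length-map inʳ (edges K)))

  disjointUnion-uniform : Uniform r K → Uniform r disjointUnion
  disjointUnion-uniform uK = All.tabulate λ e∈ → case ∈-disjointUnion⁻ e∈ of λ
    { (inj₁ (p , p∈ , refl)) → trans (∣p++⊥∣≡∣p∣ n p) (All.lookup uH p∈)
    ; (inj₂ (q , q∈ , refl)) → trans (∣⊥++q∣≡∣q∣ m q) (All.lookup uK q∈) }

  disjointUnion-linear : Linear H → Linear K → Linear disjointUnion
  disjointUnion-linear lH lK = All.tabulate λ e∈ → All.tabulate λ f∈ →
    meet (∈-disjointUnion⁻ e∈) (∈-disjointUnion⁻ f∈)
    where
    ∣∩∣ : ∀ (p p′ : Subset m) (q q′ : Subset n) →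
          ∣ (p ++ q) ∩ (p′ ++ q′) ∣ ≡ ∣ p ∩ p′ ∣ + ∣ q ∩ q′ ∣
    ∣∩∣ p p′ q q′ = trans (cong ∣_∣ (++-∩ p p′ q q′)) (∣p++q∣≡∣p∣+∣q∣ (p ∩ p′) _)

    ∣⊥∩_∣ : ∀ {k} (p : Subset k) → ∣ ⊥ ∩ p ∣ ≡ 0
    ∣⊥∩_∣ {k} p = trans (cong ∣_∣ (∩-zeroˡ p)) (∣⊥∣≡0 k)

    ∣_∩⊥∣ : ∀ {k} (p : Subset k) → ∣ p ∩ ⊥ ∣ ≡ 0
    ∣_∩⊥∣ {k} p = trans (cong ∣_∣ (∩-zeroʳ p)) (∣⊥∣≡0 k)

    meet : ∀ {e f} → Origin e → Origin f → e ≢ f → ∣ e ∩ f ∣ ≤ 1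
    meet (inj₁ (p , p∈ , refl)) (inj₁ (q , q∈ , refl)) e≢f
      rewrite ∣∩∣ p q (⊥ {n}) ⊥ | ∣⊥∩ (⊥ {n}) ∣ | ℕ.+-identityʳ ∣ p ∩ q ∣ =
        All.lookup (All.lookup lH p∈) q∈ (e≢f ∘ cong inˡ)
    meet (inj₁ (p , p∈ , refl)) (inj₂ (q , q∈ , refl)) e≢f
      rewrite ∣∩∣ p (⊥ {m}) ⊥ q | ∣⊥∩ q ∣ | ∣ p ∩⊥∣ = z≤n
    meet (inj₂ (p , p∈ , refl)) (inj₁ (q , q∈ , refl)) e≢f
      rewrite ∣∩∣ (⊥ {m}) q p ⊥ | ∣⊥∩ q ∣ | ∣ p ∩⊥∣ = z≤n
    meet (inj₂ (p , p∈ , refl)) (inj₂ (q , q∈ , refl)) e≢f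
      rewrite ∣∩∣ (⊥ {m}) ⊥ p q | ∣⊥∩ (⊥ {m}) ∣ =
        All.lookup (All.lookup lK p∈) q∈ (e≢f ∘ cong inʳ)

module _ {r t} (1≤r : 1 ≤ r) {B : Hypergraph t} (uniform : Uniform r B) where

  -- The copies occupy consecutive blocks of `t` vertices, so `quotient` is the number of the copy
  -- and `remainder` the position within it.
  copies : ∀ q → Hypergraph (q * t)
  copies zero    = hypergraph [] []
  copies (suc q) = disjointUnion 1≤r B (copies q) uniform

  size-copies : ∀ q → size (copies q) ≡ q * size B
  size-copies zero    = refl
  size-copies (suc q) = trans (size-disjointUnion 1≤r B (copies q) uniform)
    (cong (_+_ (size B)) (size-copies q))

  copies-uniform : ∀ q → Uniform r (copies q)
  copies-uniform zero    = []
  copies-uniform (suc q) = disjointUnion-uniform 1≤r B (copies q) uniform (copies-uniform q)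

  copies-linear : Linear B → ∀ q → Linear (copies q)
  copies-linear lin zero    = []
  copies-linear lin (suc q) =
    disjointUnion-linear 1≤r B (copies q) uniform lin (copies-linear lin q)

  edge-in-one-copy : ∀ q {e} → e ∈ₗ edges (copies q) →
                     ∃[ i ] (∀ {u} → u ∈ e → quotient {q} t u ≡ i)
  edge-in-one-copy (suc q) e∈ with ∈-disjointUnion⁻ 1≤r B (copies q) uniform e∈
  ... | inj₁ (p , _ , refl) = zero , λ {u} u∈ → helper u (x∈p++⊥⇒left p u∈)
    where
    helper : ∀ u → (∃[ y ] splitAt t u ≡ inj₁ y × y ∈ p) → quotient {suc q} t u ≡ zero
    helper u (y , eq , _) rewrite eq = refl
  ... | inj₂ (p , p∈ , refl) with edge-in-one-copy q p∈
  ...   | i , const = suc i , λ {u} u∈ → helper u (x∈⊥++q⇒right {t} p u∈)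
    where
    helper : ∀ u → (∃[ y ] splitAt t u ≡ inj₂ y × y ∈ p) → quotient {suc q} t u ≡ suc i
    helper u (y , eq , y∈) rewrite eq = cong suc (const y∈)

-- Images and connected subhypergraphs of the copies

x∈p⇒φx∈image : ∀ {m n} (φ : Fin m → Fin n) {p x} → x ∈ p → φ x ∈ image φ p
x∈p⇒φx∈image φ {p} {x} x∈ = lookup⇒[]= (φ x) _
  (trans (lookup∘tabulate _ (φ x)) (dec-true (preimage? φ p (φ x)) (x , x∈ , refl)))

x∈image⁻ : ∀ {m n} (φ : Fin m → Fin n) {p y} → y ∈ image φ p → ∃[ x ] x ∈ p × φ x ≡ y
x∈image⁻ φ {p} {y} y∈
  with preimage? φ p y
     | trans (sym (lookup∘tabulate (λ y → does (preimage? φ p y)) y)) ([]=⇒lookup y∈)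
... | yes pre | _  = pre
... | no _    | ()

-- The image of every hyperedge lies in one copy, so `quotient` is constant along walks, and the
-- position `remainder` alone determines a vertex of the image.
connected-in-copies⇒≤ :
  ∀ {r t} (1≤r : 1 ≤ r) {B : Hypergraph t} (uniform : Uniform r B) q {m} {T : Hypergraph m} →
  Connected T → Contains (copies 1≤r {B} uniform q) T → m ≤ t
connected-in-copies⇒≤ {t = t} 1≤r {B} uniform q {T = T} connected (φ , φ-injective , φ-edges) =
  injective⇒≤ {f = remainder {q} t ∘ φ} λ {u} {v} eq → φ-injective (begin
    φ u                                                         ≡⟨ combine-remQuot {q} t (φ u) ⟨
    combine (quotient {q} t (φ u)) (remainder {q} t (φ u))
      ≡⟨ cong₂ combine (same-copy (connected u v)) eq ⟩
    combine (quotient {q} t (φ v)) (remainder {q} t (φ v))      ≡⟨ combine-remQuot {q} t (φ v) ⟩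
    φ v                                                         ∎)
  where
  open ≡-Reasoning
  same-copy : ∀ {u v} → Star (Adjacent T) u v → quotient {q} t (φ u) ≡ quotient {q} t (φ v)
  same-copy ε = refl
  same-copy ((e , e∈ , u∈e , x∈e) ◅ walk)
    with edge-in-one-copy 1≤r {B} uniform q (All.lookup φ-edges e∈)
  ... | i , const = trans (const (x∈p⇒φx∈image φ u∈e))
                          (trans (sym (const (x∈p⇒φx∈image φ x∈e))) (same-copy walk))

-- Degrees and Steiner systems

through : ∀ {n} → Fin n → List (Subset n) → List (Subset n)
through x = filter (x ∈?_)

degree : ∀ {n} → List (Subset n) → Fin n → ℕ
degree es x = length (through x es)

sum-const : ∀ n c → sum {n} (λ _ → c) ≡ n * c
sum-const zero    c = refl
sum-const (suc n) c = cong (_+_ c) (sum-const n c)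

degree-suc : ∀ {n} b (e : Subset n) x → degree ((b ∷ e) ∷ []) (suc x) ≡ degree (e ∷ []) x
degree-suc b e x with x ∈? e
... | yes _ = refl
... | no  _ = refl

degree-[_] : ∀ {n} (e : Subset n) → sum (degree (e ∷ [])) ≡ ∣ e ∣
degree-[ [] ]        = refl
degree-[ true ∷ e ]  = cong suc (trans (sum-cong-≗ (degree-suc true e)) degree-[ e ])
degree-[ false ∷ e ] = trans (sum-cong-≗ (degree-suc false e)) degree-[ e ]

degree-∷ : ∀ {n} (e : Subset n) es x → degree (e ∷ es) x ≡ degree (e ∷ []) x + degree es x
degree-∷ e es x with x ∈? e
... | yes _ = refl
... | no  _ = refl

-- Double counting of incidences, one hyperedge at a time: each contributes its cardinality `r` to
-- the degree sum.
handshake : ∀ {n r} {es : List (Subset n)} → All (λ e → ∣ e ∣ ≡ r) es →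
            sum (degree es) ≡ length es * r
handshake {n} [] = trans (sum-const n 0) (ℕ.*-zeroʳ n)
handshake {n} {r} {e ∷ es} (∣e∣≡r ∷ uniform) = begin
  sum (degree (e ∷ es))                               ≡⟨ sum-cong-≗ (degree-∷ e es) ⟩
  sum (λ x → degree (e ∷ []) x + degree es x)         ≡⟨ ∑-distrib-+ (degree (e ∷ [])) (degree es) ⟩
  sum (degree (e ∷ [])) + sum (degree es)             ≡⟨ cong₂ _+_ (trans degree-[ e ] ∣e∣≡r)
                                                                  (handshake uniform) ⟩
  r + length es * r                                   ∎
  where open ≡-Reasoning

unique-constant⇒length≡1 : ∀ {A : Set} {xs : List A} {x} → Unique xs → x ∈ₗ xs →
                           (∀ {y} → y ∈ₗ xs → x ≡ y) → length xs ≡ 1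
unique-constant⇒length≡1 {xs = _ ∷ []} _ _ _ = refl
unique-constant⇒length≡1 {xs = y ∷ z ∷ _} ((y≢z ∷ _) ∷ _) _ const =
  contradiction (trans (sym (const (here refl))) (const (there (here refl)))) y≢z

-- The terms other than `g x` add up to `t - 1`; the `1` added on the left avoids the subtraction.
sum-single : ∀ {t} (g : Fin t → ℕ) x → (∀ {y} → y ≢ x → g y ≡ 1) → sum g + 1 ≡ g x + t
sum-single {suc t} g x g≡1 = begin
  sum g + 1                        ≡⟨ cong (_+ 1) (sum-remove {i = x} g) ⟩
  g x + sum (removeAt g x) + 1     ≡⟨ cong (λ s → g x + s + 1)
                                             (sum-cong-≗ (λ j → g≡1 (punchInᵢ≢i x j))) ⟩
  g x + sum {t} (λ _ → 1) + 1      ≡⟨ cong (λ s → g x + s + 1)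
                                             (trans (sum-const t 1) (ℕ.*-identityʳ t)) ⟩
  g x + t + 1                      ≡⟨ ℕ.+-assoc (g x) t 1 ⟩
  g x + (t + 1)                    ≡⟨ cong (_+_ (g x)) (ℕ.+-comm t 1) ⟩
  g x + suc t                      ∎
  where open ≡-Reasoning

module _ {t r} {B : Hypergraph t} (steiner : IsSteinerSystem r B) where
  open IsSteinerSystem steiner

  -- Two distinct common points lie in only one block, which would make `e` and `f` equal.
  steiner-linear : Linear B
  steiner-linear = All.tabulate λ {e} e∈ → All.tabulate λ {f} f∈ e≢f → meet e∈ f∈ e≢f
    where
    meet : ∀ {e f} → e ∈ₗ edges B → f ∈ₗ edges B → e ≢ f → ∣ e ∩ f ∣ ≤ 1
    meet {e} {f} e∈ f∈ e≢f with nonempty? (e ∩ f)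
    ... | no ¬ne rewrite Empty-unique ¬ne | ∣⊥∣≡0 t = z≤n
    ... | yes (x , x∈) = ≡⇒∣p∣≤1 λ {y} y∈ → same y (x∈p∩q⁻ e f x∈) (x∈p∩q⁻ e f y∈)
      where
      same : ∀ y → x ∈ e × x ∈ f → y ∈ e × y ∈ f → y ≡ x
      same y (xe , xf) (ye , yf) with y ≟ x
      ... | yes y≡x = y≡x
      ... | no  y≢x with pair-block y≢x
      ...   | _ , _ , unique-block =
        contradiction (trans (sym (unique-block (e∈ , ye , xe))) (unique-block (f∈ , yf , xf))) e≢f

  -- Double counting the pairs (y, block) with both x and y in the block.
  steiner-degree : ∀ x → degree (edges B) x * r + 1 ≡ degree (edges B) x + t
  steiner-degree x = begin
    length bs * r + 1              ≡⟨ cong (_+ 1) (handshake uniform′) ⟨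
    sum (degree bs) + 1            ≡⟨ sum-single (degree bs) x degree-y ⟩
    degree bs x + t                ≡⟨ cong (_+ t) degree-x ⟩
    degree (edges B) x + t         ∎
    where
    open ≡-Reasoning
    bs = through x (edges B)
    bs! : Unique bs
    bs! = Unique.filter⁺ (x ∈?_) (unique B)
    uniform′ : All (λ e → ∣ e ∣ ≡ r) bs
    uniform′ = All.tabulate (All.lookup uniform ∘ proj₁ ∘ ∈-filter⁻ (x ∈?_))
    degree-x : degree bs x ≡ degree (edges B) x
    degree-x = cong length (filter-all (x ∈?_) {bs}
      (All.tabulate (proj₂ ∘ ∈-filter⁻ (x ∈?_) {xs = edges B})))
    degree-y : ∀ {y} → y ≢ x → degree bs y ≡ 1
    degree-y {y} y≢x with pair-block y≢x
    ... | e , (e∈ , y∈e , x∈e) , unique-block = unique-constant⇒length≡1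
      (Unique.filter⁺ (y ∈?_) bs!)
      (∈-filter⁺ (y ∈?_) (∈-filter⁺ (x ∈?_) e∈ x∈e) y∈e)
      λ f∈ → let f∈bs , y∈f = ∈-filter⁻ (y ∈?_) {xs = bs} f∈
                 f∈B , x∈f = ∈-filter⁻ (x ∈?_) {xs = edges B} f∈bs
             in unique-block (f∈B , y∈f , x∈f)

-- With t = rK + 1 the previous count reads d(r + 1) + 1 = d + rK + 1, i.e. d = K.
steiner-size : ∀ {r K} → 1 ≤ r → {B : Hypergraph (r * K + 1)} → IsSteinerSystem (suc r) B →
               size B * suc r ≡ (r * K + 1) * K
steiner-size {r@(suc _)} {K} 1≤r {B} steiner = begin
  size B * suc r                    ≡⟨ handshake (IsSteinerSystem.uniform steiner) ⟨
  sum (degree (edges B))            ≡⟨ sum-cong-≗ degree≡K ⟩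
  sum {r * K + 1} (λ _ → K)         ≡⟨ sum-const (r * K + 1) K ⟩
  (r * K + 1) * K                   ∎
  where
  open ≡-Reasoning
  degree≡K : ∀ x → degree (edges B) x ≡ K
  degree≡K x = ℕ.*-cancelˡ-≡ _ _ r (ℕ.+-cancelˡ-≡ d _ _ (ℕ.+-cancelʳ-≡ 1 _ _ (begin
    d + r * d + 1      ≡⟨ cong (λ s → d + s + 1) (ℕ.*-comm r d) ⟩
    d + d * r + 1      ≡⟨ cong (_+ 1) (ℕ.*-suc d r) ⟨
    d * suc r + 1      ≡⟨ steiner-degree steiner x ⟩
    d + (r * K + 1)    ≡⟨ ℕ.+-assoc d (r * K) 1 ⟨
    d + r * K + 1      ∎)))
    where d = degree (edges B) x

-- Stars

-- The centre joins any two vertices by a walk of two steps. Distinct rays meet only there, so all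
-- intersections along a cycle would coincide, against their required distinctness.
star⇒hypertree : ∀ {m r k} {S : Hypergraph m} → IsLinearStar r k S → IsLinearHypertree r k S
star⇒hypertree {S = S} star = record
  { connected = λ u v → let e , e∈ , u∈ = covered u
                            f , f∈ , v∈ = covered v
                        in (e , e∈ , u∈ , centred e∈) ◅ (f , f∈ , centred f∈ , v∈) ◅ ε
  ; acyclic = no-cycle
  ; linear  = All.tabulate λ e∈ → All.tabulate λ f∈ e≢f →
      ℕ.≤-reflexive (trans (cong ∣_∣ (disjoint e∈ f∈ e≢f)) (∣⁅x⁆∣≡1 centre))
  ; uniform = uniform
  ; size≡k  = size≡k
  }
  where
  open IsLinearStar star
  no-cycle : Acyclic S
  no-cycle {zero} c record { length≥3 = s≤s () }
  no-cycle {suc s} c cyc = case distinct-intersections {zero} {suc zero}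
    (trans (at-centre zero) (sym (at-centre (suc zero)))) of λ ()
    where
    open IsCycle cyc
    at-centre : ∀ i → c i ∩ c (cyclicSuc i) ≡ ⁅ centre ⁆
    at-centre i = disjoint (hyperedges i) (hyperedges (cyclicSuc i)) (cyclicSuc≢id i ∘ distinct)

-- A bijection from `p` onto `q`, carried by a total function whose values outside `p` are ignored.
record Matching {m n} (p : Subset m) (q : Subset n) : Set where
  field
    fun        : Fin m → Fin n
    maps       : ∀ {x} → x ∈ p → fun x ∈ q
    injective  : ∀ {x y} → x ∈ p → y ∈ p → fun x ≡ fun y → x ≡ y
    surjective : ∀ {y} → y ∈ q → ∃[ x ] x ∈ p × fun x ≡ y

-- The point of Fin n is a junk value outside p.
matching : ∀ {m n} (p : Subset m) (q : Subset n) → Fin n → ∣ p ∣ ≡ ∣ q ∣ → Matching p q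
matching [] q _ eq = record
  { fun = λ () ; maps = λ () ; injective = λ ()
  ; surjective = λ y∈ → contradiction (subst (1 ≤_) (sym eq) (1≤∣p∣ y∈)) λ () }
matching (false ∷ p) q d eq = record
  { fun        = d ∷ᶠ fun
  ; maps       = λ { (there x∈) → maps x∈ }
  ; injective  = λ { (there x∈) (there y∈) eq → cong suc (injective x∈ y∈ eq) }
  ; surjective = λ y∈ → let x , x∈ , eq = surjective y∈ in suc x , there x∈ , eq }
  where open Matching (matching p q d eq)
matching {n = n} (true ∷ p) q d eq with 1≤∣p∣⇒nonempty q (subst (1 ≤_) eq (s≤s z≤n))
... | y , y∈q = record
  { fun        = y ∷ᶠ fun
  ; maps       = λ { here → y∈q ; (there x∈) → p─q⊆p q ⁅ y ⁆ (maps x∈) }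
  ; injective  = λ
      { here       here       _   → refl
      ; here       (there z∈) eq′ → contradiction (sym eq′) (avoids z∈)
      ; (there x∈) here       eq′ → contradiction eq′ (avoids x∈)
      ; (there x∈) (there z∈) eq′ → cong suc (injective x∈ z∈ eq′) }
  ; surjective = onto }
  where
  open Matching (matching p (q - y) d (ℕ.suc-injective (trans eq (x∈p⇒∣p∣≡1+∣p-x∣ y∈q))))
  avoids : ∀ {x} → x ∈ p → fun x ≢ y
  avoids x∈ fx≡y = x∉p-x q y (subst (_∈ q - y) fx≡y (maps x∈))
  onto : ∀ {z} → z ∈ q → ∃[ x ] x ∈ true ∷ p × (y ∷ᶠ fun) x ≡ z
  onto {z} z∈ with z ≟ y
  ... | yes refl = zero , here , refl
  ... | no z≢y with surjective (x∈p∧x≢y⇒x∈p-y z∈ z≢y)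
  ...   | x , x∈ , eq′ = suc x , there x∈ , eq′

-- Embedding a star at a vertex of large degree

module _ {m n r k} {S : Hypergraph m} (star : IsLinearStar r k S)
         {H : Hypergraph n} (linear : Linear H) (uniform : Uniform r H)
         (x : Fin n) (k≤deg : k ≤ degree (edges H) x) where

  private
    module S = IsLinearStar star
    c = S.centre

    s≤deg : size S ≤ degree (edges H) x
    s≤deg = subst (_≤ degree (edges H) x) (sym S.size≡k) k≤deg

    E : Fin (size S) → Subset m
    E = lookup (edges S)

    -- The rays are paired with the first `size S` hyperedges through `x`, which exist by the degree
    -- bound.
    F : Fin (size S) → Subset n
    F i = lookup (through x (edges H)) (inject≤ i s≤deg)

    E∈ : ∀ i → E i ∈ₗ edges S
    E∈ i = ∈-lookup {xs = edges S} i

    F∈ : ∀ i → F i ∈ₗ edges H × x ∈ F i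
    F∈ i = ∈-filter⁻ (x ∈?_) {xs = edges H} (∈-lookup {xs = through x (edges H)} (inject≤ i s≤deg))

    F-injective : Injective _≡_ _≡_ F
    F-injective eq = inject≤-injective s≤deg s≤deg _ _
      (lookup-injective (Unique.filter⁺ (x ∈?_) (unique H)) eq)

    match : ∀ i → Matching (E i - c) (F i - x)
    match i = matching (E i - c) (F i - x) x (ℕ.suc-injective (begin
      suc ∣ E i - c ∣  ≡⟨ x∈p⇒∣p∣≡1+∣p-x∣ (S.centred (E∈ i)) ⟨
      ∣ E i ∣          ≡⟨ All.lookup S.uniform (E∈ i) ⟩
      r                ≡⟨ All.lookup uniform (proj₁ (F∈ i)) ⟨
      ∣ F i ∣          ≡⟨ x∈p⇒∣p∣≡1+∣p-x∣ (proj₂ (F∈ i)) ⟩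
      suc ∣ F i - x ∣  ∎))
      where open ≡-Reasoning

    g : Fin (size S) → Fin m → Fin n
    g i = Matching.fun (match i)

    -- The ray through `v` picked by `covered`. It is forced when `v` is not the centre and
    -- arbitrary at the centre, which `φ` therefore treats separately.
    ray : Fin m → Fin (size S)
    ray v = index (proj₁ (proj₂ (S.covered v)))

    ∈ray : ∀ v → v ∈ E (ray v)
    ∈ray v with S.covered v
    ... | e , e∈ , v∈e = subst (v ∈_) (lookup-index e∈) v∈e

    ray-unique : ∀ {v i} → v ∈ E i → v ≢ c → ray v ≡ i
    ray-unique {v} {i} v∈ v≢c with ray v ≟ i
    ... | yes eq = eq
    ... | no neq = contradiction (x∈⁅y⁆⇒x≡y c (subst (v ∈_)
      (S.disjoint (E∈ (ray v)) (E∈ i) (neq ∘ lookup-injective (unique S)))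
      (x∈p∩q⁺ (∈ray v , v∈)))) v≢c

    φ : Fin m → Fin n
    φ v with v ≟ c
    ... | yes _ = x
    ... | no  _ = g (ray v) v

    φ-centre : φ c ≡ x
    φ-centre with c ≟ c
    ... | yes _  = refl
    ... | no c≢c = contradiction refl c≢c

    φ-off : ∀ {i v} → v ∈ E i → v ≢ c → φ v ≡ g i v
    φ-off {i} {v} v∈ v≢c with v ≟ c
    ... | yes v≡c = contradiction v≡c v≢c
    ... | no  _   = cong (λ j → g j v) (ray-unique v∈ v≢c)

    g∈ : ∀ {i v} → v ∈ E i → v ≢ c → g i v ∈ F i - x
    g∈ {i} v∈ v≢c = Matching.maps (match i) (x∈p∧x≢y⇒x∈p-y v∈ v≢c)

    g≢x : ∀ {i v} → v ∈ E i → v ≢ c → g i v ≢ x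
    g≢x {i} v∈ v≢c eq = x∉p-x (F i) x (subst (_∈ F i - x) eq (g∈ v∈ v≢c))

    φ≢x : ∀ {v} → v ≢ c → φ v ≢ x
    φ≢x {v} v≢c eq = g≢x (∈ray v) v≢c (trans (sym (φ-off (∈ray v) v≢c)) eq)

    φ∈ : ∀ {i v} → v ∈ E i → φ v ∈ F i
    φ∈ {i} {v} v∈ = case v ≟ c of λ
      { (yes refl) → subst (_∈ F i) (sym φ-centre) (proj₂ (F∈ i))
      ; (no  v≢c)  → subst (_∈ F i) (sym (φ-off v∈ v≢c)) (p─q⊆p (F i) ⁅ x ⁆ (g∈ v∈ v≢c)) }

    φ-injective : Injective _≡_ _≡_ φ
    φ-injective {v} {w} eq = case v ≟ c of λ
      { (yes refl) → case w ≟ c of λ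
          { (yes refl) → refl
          ; (no  w≢c)  → contradiction (trans (sym eq) φ-centre) (φ≢x w≢c) }
      ; (no v≢c) → case w ≟ c of λ
          { (yes refl) → contradiction (trans eq φ-centre) (φ≢x v≢c)
          ; (no  w≢c)  → off-centre v≢c w≢c (ray v ≟ ray w) } }
      where
      off-centre : v ≢ c → w ≢ c → Dec (ray v ≡ ray w) → v ≡ w
      off-centre v≢c w≢c (yes same) = Matching.injective (match (ray w))
        (x∈p∧x≢y⇒x∈p-y v∈ v≢c) (x∈p∧x≢y⇒x∈p-y (∈ray w) w≢c)
        (trans (sym (φ-off v∈ v≢c)) (trans eq (φ-off (∈ray w) w≢c)))
        where v∈ = subst (λ i → v ∈ E i) same (∈ray v)
      -- On different rays, `φ v` and `x` would both lie in two distinct hyperedges of `H`, so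
      -- linearity would give `φ v ≡ x`.
      off-centre v≢c w≢c (no different) = contradiction
        (linear⇒≡ {H = H} linear (proj₁ (F∈ (ray v))) (proj₁ (F∈ (ray w))) (different ∘ F-injective)
          (φ∈ (∈ray v)) (subst (_∈ F (ray w)) (sym eq) (φ∈ (∈ray w)))
          (proj₂ (F∈ (ray v))) (proj₂ (F∈ (ray w))))
        (φ≢x v≢c)

    -- An embedding must send hyperedges onto hyperedges, so surjectivity of the matchings enters
    -- here, while the centre accounts for `x`.
    image-ray : ∀ i → image φ (E i) ≡ F i
    image-ray i = ⊆-antisym
      (λ y∈ → case x∈image⁻ φ y∈ of λ { (v , v∈ , refl) → φ∈ v∈ })
      (λ {y} y∈ → onto y∈ (y ≟ x))
      where
      onto : ∀ {y} → y ∈ F i → Dec (y ≡ x) → y ∈ image φ (E i)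
      onto _ (yes refl) = subst (_∈ image φ (E i)) φ-centre (x∈p⇒φx∈image φ (S.centred (E∈ i)))
      onto {y} y∈ (no y≢x) with Matching.surjective (match i) (x∈p∧x≢y⇒x∈p-y y∈ y≢x)
      ... | v , v∈- , gv≡y = subst (_∈ image φ (E i)) (trans (φ-off v∈ v≢c) gv≡y)
        (x∈p⇒φx∈image φ v∈)
        where
        v∈ = p─q⊆p (E i) ⁅ c ⁆ v∈-
        v≢c : v ≢ c
        v≢c refl = x∉p-x (E i) c v∈-

  -- The matchings glue to an injection because the chosen hyperedges pairwise share only `x`.
  star-embeds : Contains H S
  star-embeds = φ , φ-injective , All.tabulate λ {e} e∈ →
    subst (λ f → image φ f ∈ₗ edges H) (sym (lookup-index e∈))
      (subst (_∈ₗ edges H) (sym (image-ray (index e∈))) (proj₁ (F∈ (index e∈))))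

-- Degree bound for the star and both estimates in natural numbers

sum-≤ : ∀ {n c} (g : Fin n → ℕ) → (∀ x → g x ≤ c) → sum g ≤ n * c
sum-≤ {zero}  g g≤c = z≤n
sum-≤ {suc n} g g≤c = ℕ.+-mono-≤ (g≤c zero) (sum-≤ (g ∘ suc) (g≤c ∘ suc))

star-free-size : ∀ {m n r K} {S : Hypergraph m} → IsLinearStar r (suc K) S →
                 (H : Hypergraph n) → Admissible r S H → size H * r ≤ n * K
star-free-size {n = n} {K = K} star H (admissible linear uniform free) =
  subst (_≤ n * K) (handshake uniform) (sum-≤ (degree (edges H)) λ x →
    ℕ.≮⇒≥ λ K<deg → free (star-embeds star {H = H} linear uniform x K<deg))

module _ {r K q : ℕ} (1≤r : 1 ≤ r) {B : Hypergraph (r * K + 1)}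
         (steiner : IsSteinerSystem (suc r) B) where
  open IsSteinerSystem steiner

  steiner-copies : Hypergraph (q * (r * K + 1))
  steiner-copies = copies (s≤s z≤n) {B} uniform q

  steiner-copies-size : size steiner-copies * suc r ≡ q * (r * K + 1) * K
  steiner-copies-size = begin
    size steiner-copies * suc r    ≡⟨ cong (_* suc r) (size-copies (s≤s z≤n) {B} uniform q) ⟩
    q * size B * suc r             ≡⟨ ℕ.*-assoc q (size B) (suc r) ⟩
    q * (size B * suc r)           ≡⟨ cong (q *_) (steiner-size 1≤r steiner) ⟩
    q * ((r * K + 1) * K)          ≡⟨ ℕ.*-assoc q (r * K + 1) K ⟨
    q * (r * K + 1) * K            ∎
    where open ≡-Reasoning

  steiner-copies-admissible : ∀ {m} {T : Hypergraph m} → IsLinearHypertree (suc r) (suc K) T →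
                              Admissible (suc r) T steiner-copies
  steiner-copies-admissible {m} {T} tree = admissible
    (copies-linear (s≤s z≤n) {B} uniform (steiner-linear steiner) q)
    (copies-uniform (s≤s z≤n) {B} uniform q)
    λ emb → ℕ.<⇒≱ too-large (connected-in-copies⇒≤ (s≤s z≤n) {B} uniform q {T = T} T.connected emb)
    where
    module T = IsLinearHypertree tree
    -- `T` has a first hyperedge, which is nonempty; a vertex of it serves as the root.
    root : ∀ {k} → size T ≡ suc k → Uniform (suc r) T → Fin m
    root size≡ uni with edges T
    root ()    _         | []
    root _     (∣e∣ ∷ _) | e ∷ _ = proj₁ (1≤∣p∣⇒nonempty e (subst (1 ≤_) (sym ∣e∣) (s≤s z≤n)))

    too-large : r * K + 1 < m
    too-large = begin-strict
      -- Strict because `1 ≤ r`: one hyperedge beyond `K` costs `r` further vertices.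
      r * K + 1        <⟨ ℕ.+-monoˡ-< 1 (ℕ.m<n+m (r * K) 1≤r) ⟩
      r + r * K + 1    ≡⟨ cong (_+ 1) (ℕ.*-suc r K) ⟨
      r * suc K + 1    ≡⟨ cong (λ s → r * s + 1) T.size≡k ⟨
      r * size T + 1   ≤⟨ hypertree-order T.acyclic T.linear T.connected T.uniform
                            (root T.size≡k T.uniform) ⟩
      m                ∎
      where open ℕ.≤-Reasoning

  -- The bound with its denominator `suc r` cleared; `K` stands for `k - 1` and `q * (r * K + 1)`
  -- for `n`.
  turán-lower : ∀ {m} {T : Hypergraph m} → IsLinearHypertree (suc r) (suc K) T →
                q * (r * K + 1) * K ≤ exˡⁱⁿ (suc r) (q * (r * K + 1)) T * suc r
  turán-lower {T = T} tree = subst (_≤ exˡⁱⁿ (suc r) (q * (r * K + 1)) T * suc r)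
    steiner-copies-size
    (ℕ.*-monoˡ-≤ (suc r) (exˡⁱⁿ-upper (suc r) T steiner-copies (steiner-copies-admissible tree)))

  turán-star : ∀ {m} {S : Hypergraph m} → IsLinearStar (suc r) (suc K) S →
               exˡⁱⁿ (suc r) (q * (r * K + 1)) S * suc r ≡ q * (r * K + 1) * K
  turán-star {S = S} star = ℕ.≤-antisym upper (turán-lower tree)
    where
    tree = star⇒hypertree star
    upper : exˡⁱⁿ (suc r) (q * (r * K + 1)) S * suc r ≤ q * (r * K + 1) * K
    -- The maximum is attained because the Steiner copies are admissible; the degree bound then
    -- applies to a maximiser `H`.
    upper with exˡⁱⁿ-attained (suc r) S steiner-copies (steiner-copies-admissible tree)
    ... | H , size≡ex , adm = subst (λ s → s * suc r ≤ _) size≡ex (star-free-size star H adm)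

-- Passage to rational numbers

*≤⇒/≤ : ∀ a b r → b ≤ a * suc r → (+ a) / 1 ≥ℚ (+ b) / suc r
-- `_/_` reduces fractions, so the comparison is made between unnormalised ones, where it is cross
-- multiplication. `mkℚᵘ` stores the denominator minus one.
*≤⇒/≤ a b r b≤ = toℚᵘ-cancel-≤ (begin
  toℚᵘ ((+ b) / suc r)    ≃⟨ toℚᵘ-fromℚᵘ (mkℚᵘ (+ b) r) ⟩
  mkℚᵘ (+ b) r            ≤⟨ *≤* (subst₂ ℤ._≤_ (sym (ℤ.*-identityʳ (+ b)))
                                        (ℤ.pos-* a (suc r)) (+≤+ b≤)) ⟩
  mkℚᵘ (+ a) 0            ≃⟨ toℚᵘ-fromℚᵘ (mkℚᵘ (+ a) 0) ⟨
  toℚᵘ ((+ a) / 1)        ∎)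
  where
  open ℚᵘ.≤-Reasoning

*≡⇒/≡ : ∀ a b r → a * suc r ≡ b → (+ a) / 1 ≡ (+ b) / suc r
*≡⇒/≡ a b r eq = fromℚᵘ-cong {mkℚᵘ (+ a) 0} {mkℚᵘ (+ b) r}
  (*≡* (trans (sym (ℤ.pos-* a (suc r))) (trans (cong +_ eq) (sym (ℤ.*-identityʳ (+ b))))))

theorem2 : (r k n : ℕ) .{{_ : NonZero r}} → 3 ≤ r → 2 ≤ k → 1 ≤ n →
    let t = (r ∸ 1) * (k ∸ 1) + 1 in
    t ∣ n →
    (∃[ B ] IsSteinerSystem {t} r B) →
    ((m : ℕ) (T : Hypergraph m) → IsLinearHypertree r k T →
    (+ exˡⁱⁿ r n T) / 1 ≥ℚ (+ (n * (k ∸ 1))) / r)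
    ×
    ((m : ℕ) (S : Hypergraph m) → IsLinearStar r k S →
    (+ exˡⁱⁿ r n S) / 1 ≡ (+ (n * (k ∸ 1))) / r)
-- With `suc r` and `suc K` the order `t` computes to `r * K + 1`, and `divides q refl` replaces `n`
-- by `q * (r * K + 1)`.
theorem2 (suc r) (suc K) n (s≤s 2≤r) _ _ (divides q refl) (B , steiner) =
  (λ m T tree → *≤⇒/≤ (exˡⁱⁿ (suc r) n T) (n * K) r (turán-lower {q = q} 1≤r steiner tree)) ,
  (λ m S star → *≡⇒/≡ (exˡⁱⁿ (suc r) n S) (n * K) r (turán-star {q = q} 1≤r steiner star))
  where
  1≤r : 1 ≤ r
  1≤r = ℕ.<⇒≤ 2≤r
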